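{- Let $N\ge1$ and $X=\{1,\dots,N\}$. A type $\mathcal M$ on $X$ is realizable if and only if it is admissible.
   Context: A shape is a multiset of nonnegative integers whose sum is at most $N$; for a shape $M$ and integer $x$, $\mu_M(x)$ is the number of entries of $M$ equal to $x$. A type is a multiset of shapes $\{M_1,\dots,M_k\}$; it is admissible if $\sum_{i=1}^k\mu_{M_i}(x)\le\binom{N}{x}$ for all $0\le x\le N$. For $\mathcal S\subseteq\mathcal P(X)$, a partial spread in $\mathcal S$ is a subset $\mathcal C\subseteq\mathcal S$ any two distinct members of which are disjoint; its shape is $\{|C|:C\in\mathcal C\}$. A disjoint partial spread system on $\mathcal S$ is a partition of $\mathcal S$ into partial spreads, and its type is the multiset of the shapes of its partial spreads. A type is realizable if it is the type of a disjoint partial spread system on some $\mathcal S\subseteq\mathcal P(X)$. -}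

module Defs where

open import Data.Nat using (ℕ; _≤_; _≟_)
open import Data.Nat.Combinatorics using (_C_)
open import Data.List using (List; map; concat; filter; length)
open import Data.Nat.ListAction using (sum)
open import Data.List.Relation.Unary.All using (All)
open import Data.List.Relation.Unary.AllPairs using (AllPairs)
open import Data.List.Relation.Unary.Unique.Propositional using (Unique)
open import Data.List.Relation.Binary.Permutation.Propositional using (_↭_)
open import Data.List.Relation.Binary.Pointwise using (Pointwise)
open import Data.Fin.Subset using (Subset; ∣_∣; _∩_; Empty)
open import Data.Product using (Σ)

-- Multisets are represented by lists, compared up to permutation where relevant.

Shape : Set
Shape = List ℕ

IsShape : ℕ → Shape → Set
IsShape N M = sum M ≤ N

Type : Set
Type = List Shape

μ : Shape → ℕ → ℕ
μ M x = length (filter (x ≟_) M)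

Admissible : ℕ → Type → Set
Admissible N T = ∀ x → x ≤ N → sum (map (λ M → μ M x) T) ≤ N C x

Disjoint : ∀ {N} → Subset N → Subset N → Set
Disjoint A B = Empty (A ∩ B)

-- A partial spread (listed without repetition; repetition is excluded
-- globally by the Unique condition on the whole system).
IsPartialSpread : ∀ {N} → List (Subset N) → Set
IsPartialSpread = AllPairs Disjoint

shapeOf : ∀ {N} → List (Subset N) → Shape
shapeOf C = map ∣_∣ C

-- A disjoint partial spread system: a list of partial spreads whose union
-- S (= concat) has no repeated member, i.e. the blocks partition S.
IsDPSS : ∀ {N} → List (List (Subset N)) → Set
IsDPSS {N} 𝒞 = Unique (concat 𝒞) × All IsPartialSpread 𝒞
  where open import Data.Product using (_×_)

-- T is realizable: it is the type of some DPSS on some S ⊆ P(X).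
-- The multiset equality of types is witnessed by listing the partial
-- spreads in the same order as T, with shapes equal up to permutation.
Realizable : ℕ → Type → Set
Realizable N T =
  Σ (List (List (Subset N))) λ 𝒞 →
    IsDPSS 𝒞 × Pointwise (λ C M → shapeOf C ↭ M) 𝒞 T
  where open import Data.Product using (_×_)

{-# OPTIONS --safe #-}

-- Necessity: the members of size x are distinct x-subsets.
--
-- Sufficiency follows Baranyai's method. Padding with singleton shapes makes admissibility an equality
-- for every x. Then the elements of X are handed out one at a time. With n elements left, each member
-- is known by its trace S on the elements already handed out and the number k of elements it still
-- needs; the needs within a partial spread add up to at most n, and exactly n C k members have a given
-- (k , S). If every member took the next element with probability k / n, each spread would use it at most
-- once in expectation, exactly once if its needs add up to n, and the expected number of members
-- (k , S) taking it would be (n-1) C (k-1). These quantities are integral up to slack, so an integral choice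
-- with the same properties exists: this is Hall's theorem, obtained by augmenting an assignment of
-- classes (k , S) to spreads until every class is served as often as required. After all N elements
-- have been handed out, 0 C 0 = 1 says that no subset is used twice.
module Submission where

open import Defs
open import Data.Nat using (ℕ; _≤_)
open import Data.List.Relation.Unary.All using (All)
open import Function.Bundles using (_⇔_)

open import Data.Bool using (if_then_else_; true; false)
open import Data.Nat using (_≟_; zero; suc; pred; _+_; _*_; _∸_; _<_; _<?_; z≤n; s≤s; NonZero)
open import Data.Nat.Properties hiding (_≟_)
open import Data.Nat.Combinatorics using (_C_; nC1≡n; nCn≡1; nCk≡nC[n∸k]; nCk+nC[k+1]≡[n+1]C[k+1])
open import Data.Nat.ListAction using (sum)
open import Data.Nat.ListAction.Properties using (sum-↭; sum-++)
open import Data.Nat.Tactic.RingSolver using (solve-∀)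
open import Data.Fin using (Fin; zero; suc)
import Data.Fin as Fin
open import Data.List using (List; []; _∷_; [_]; _++_; map; length; concat; allFin; replicate; tabulate;
  upTo; cartesianProduct; lookup)
open import Data.List.Properties using (map-++; map-∘; map-id; map-cong-local; concat-++;
  map-tabulate; tabulate-lookup; length-tabulate)
open import Data.List.Membership.Propositional using (_∈_; _∉_; find; lose)
open import Data.List.Membership.Propositional.Properties
open import Data.List.Relation.Binary.Subset.Propositional using (_⊆_)
open import Data.List.Relation.Unary.Any using (here; there; any?)
open import Data.List.Relation.Unary.Unique.Propositional using (Unique)
open import Data.List.Relation.Unary.Unique.Propositional.Properties using (allFin⁺; Unique[x∷xs]⇒x∉xs)
import Data.List.Relation.Unary.Unique.Propositional.Properties as Unique
open import Data.List.Relation.Binary.Permutation.Propositional using (_↭_; ↭-sym; ↭-trans; ↭-reflexive)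
open import Data.List.Relation.Binary.Permutation.Propositional.Properties using (∈-resp-↭; shift)
import Data.List.Relation.Binary.Permutation.Propositional.Properties as Perm
open import Data.List.Relation.Unary.AllPairs using (AllPairs; []; _∷_)
open import Data.List.Relation.Unary.All using ([]; _∷_)
import Data.List.Relation.Unary.All as All
import Data.List.Relation.Unary.All.Properties as All
import Data.List.Relation.Unary.AllPairs.Properties as AllPairs
import Data.List.Relation.Binary.Pointwise as Pointwise
open import Data.List.Relation.Binary.Pointwise using (Pointwise; []; _∷_)
open import Data.Maybe using (Maybe; just; nothing)
import Data.Maybe.Properties as Maybe
open import Data.Maybe.Properties using (just-injective)
import Data.Maybe.Relation.Unary.Any as MAny
open import Data.Product using (∃; ∃₂; _×_; _,_; proj₁; proj₂)
import Data.Product.Properties as Product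
import Data.Bool.Properties as Bool
open import Data.Vec using ([]; _∷_; here; there)
import Data.Vec.Properties as Vec
open import Data.Fin.Subset using (Subset; inside; outside; ∣_∣)
open import Data.Sum using (_⊎_; inj₁; inj₂)
open import Data.Empty using (⊥; ⊥-elim)
open import Function using (_∘_; const)
open import Function.Bundles using (mk⇔)
open import Relation.Nullary using (Dec; does; yes; no; ¬_; contradiction; ¬?)
open import Relation.Nullary.Decidable using (_×-dec_)
open import Relation.Binary.Definitions using (DecidableEquality)
open import Relation.Binary.PropositionalEquality hiding ([_])

private variable
  A B P Q : Set

-- Finite sums over lists

∑ : List A → (A → ℕ) → ℕ
∑ xs f = sum (map f xs)

infix 5 ∑
syntax ∑ xs (λ x → e) = ∑[ x ← xs ] e

∑-cong : ∀ (xs : List A) {f g : A → ℕ} → (∀ {x} → x ∈ xs → f x ≡ g x) → ∑ xs f ≡ ∑ xs g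
∑-cong []       f≡g = refl
∑-cong (x ∷ xs) f≡g = cong₂ _+_ (f≡g (here refl)) (∑-cong xs (f≡g ∘ there))

∑-mono-≤ : ∀ (xs : List A) {f g : A → ℕ} → (∀ {x} → x ∈ xs → f x ≤ g x) → ∑ xs f ≤ ∑ xs g
∑-mono-≤ []       f≤g = z≤n
∑-mono-≤ (x ∷ xs) f≤g = +-mono-≤ (f≤g (here refl)) (∑-mono-≤ xs (f≤g ∘ there))

∑-mono-< : ∀ {xs : List A} {f g : A → ℕ} {x} → x ∈ xs → (∀ {y} → y ∈ xs → f y ≤ g y) → f x < g x →
           ∑ xs f < ∑ xs g
∑-mono-< (here refl) f≤g fx<gx = +-mono-<-≤ fx<gx (∑-mono-≤ _ (f≤g ∘ there))
∑-mono-< (there x∈)  f≤g fx<gx = +-mono-≤-< (f≤g (here refl)) (∑-mono-< x∈ (f≤g ∘ there) fx<gx)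

∑-const : ∀ (xs : List A) n → (∑[ x ← xs ] n) ≡ n * length xs
∑-const []       n = sym (*-zeroʳ n)
∑-const (x ∷ xs) n = trans (cong (n +_) (∑-const xs n)) (sym (*-suc n (length xs)))

∑-zero : ∀ (xs : List A) {f : A → ℕ} → (∀ {x} → x ∈ xs → f x ≡ 0) → ∑ xs f ≡ 0
∑-zero xs f≡0 = trans (∑-cong xs f≡0) (∑-const xs 0)

∑-+ : ∀ (xs : List A) (f g : A → ℕ) → (∑[ x ← xs ] (f x + g x)) ≡ ∑ xs f + ∑ xs g
∑-+ []       f g = refl
∑-+ (x ∷ xs) f g rewrite ∑-+ xs f g = interchange (f x) (g x) (∑ xs f) (∑ xs g)
  where
  interchange : ∀ a b c d → a + b + (c + d) ≡ a + c + (b + d)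
  interchange = solve-∀

∑-*ˡ : ∀ (xs : List A) n (f : A → ℕ) → (∑[ x ← xs ] (n * f x)) ≡ n * ∑ xs f
∑-*ˡ []       n f = sym (*-zeroʳ n)
∑-*ˡ (x ∷ xs) n f = trans (cong (n * f x +_) (∑-*ˡ xs n f)) (sym (*-distribˡ-+ n (f x) (∑ xs f)))

∑-*ʳ : ∀ (xs : List A) n (f : A → ℕ) → (∑[ x ← xs ] (f x * n)) ≡ ∑ xs f * n
∑-*ʳ []       n f = refl
∑-*ʳ (x ∷ xs) n f = trans (cong (f x * n +_) (∑-*ʳ xs n f)) (sym (*-distribʳ-+ n (f x) (∑ xs f)))

∑-swap : ∀ (xs : List A) (ys : List B) (f : A → B → ℕ) →
         (∑[ x ← xs ] ∑[ y ← ys ] f x y) ≡ (∑[ y ← ys ] ∑[ x ← xs ] f x y)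
∑-swap []       ys f = sym (∑-zero ys (λ _ → refl))
∑-swap (x ∷ xs) ys f = trans (cong (∑ ys (f x) +_) (∑-swap xs ys f)) (sym (∑-+ ys (f x) _))

∑-++ : ∀ (xs ys : List A) (f : A → ℕ) → ∑ (xs ++ ys) f ≡ ∑ xs f + ∑ ys f
∑-++ xs ys f = trans (cong sum (map-++ f xs ys)) (sum-++ (map f xs) (map f ys))

∑-map : ∀ (g : A → B) xs (f : B → ℕ) → ∑ (map g xs) f ≡ ∑ xs (f ∘ g)
∑-map g xs f = cong sum (sym (map-∘ xs))

∑-concat : ∀ (xss : List (List A)) (f : A → ℕ) → ∑ (concat xss) f ≡ (∑[ xs ← xss ] ∑ xs f)
∑-concat []         f = refl
∑-concat (xs ∷ xss) f = trans (∑-++ xs (concat xss) f) (cong (∑ xs f +_) (∑-concat xss f))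

∑-↭ : ∀ {xs ys : List A} (f : A → ℕ) → xs ↭ ys → ∑ xs f ≡ ∑ ys f
∑-↭ f xs↭ys = sum-↭ (Perm.map⁺ f xs↭ys)

∑-∈-≤ : ∀ {xs : List A} (f : A → ℕ) {x} → x ∈ xs → f x ≤ ∑ xs f
∑-∈-≤ f (here refl) = m≤m+n _ _
∑-∈-≤ f (there x∈)  = ≤-trans (∑-∈-≤ f x∈) (m≤n+m _ _)

∑-exchange : ∀ {xs : List A} {f g : A → ℕ} {x} → Unique xs → x ∈ xs → (∀ {y} → y ≢ x → f y ≡ g y) →
             ∑ xs f + g x ≡ ∑ xs g + f x
∑-exchange {xs = x ∷ xs} {f} {g} u@(_ ∷ _) (here refl) f≡g
  rewrite ∑-cong xs {f} {g} (λ y∈ → f≡g (λ { refl → Unique[x∷xs]⇒x∉xs u y∈ })) = rotate (f x) (∑ xs g) (g x)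
  where
  rotate : ∀ a b c → a + b + c ≡ c + b + a
  rotate = solve-∀
∑-exchange {xs = y ∷ xs} {f} {g} {x} u@(_ ∷ uxs) (there x∈) f≡g = begin
  f y + ∑ xs f + g x    ≡⟨ +-assoc (f y) _ _ ⟩
  f y + (∑ xs f + g x)  ≡⟨ cong₂ _+_ (f≡g λ { refl → Unique[x∷xs]⇒x∉xs u x∈ }) (∑-exchange uxs x∈ f≡g) ⟩
  g y + (∑ xs g + f x)  ≡⟨ +-assoc (g y) _ _ ⟨
  g y + ∑ xs g + f x    ∎
  where open ≡-Reasoning

-- Indicators and multiplicities

⟦_⟧ : Dec P → ℕ
⟦ p? ⟧ = if does p? then 1 else 0

⟦⟧-yes : (p? : Dec P) → P → ⟦ p? ⟧ ≡ 1
⟦⟧-yes (yes _) p = refl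
⟦⟧-yes (no ¬p) p = contradiction p ¬p

⟦⟧-no : (p? : Dec P) → ¬ P → ⟦ p? ⟧ ≡ 0
⟦⟧-no (yes p) ¬p = contradiction p ¬p
⟦⟧-no (no _)  ¬p = refl

⟦⟧-cong : (p? : Dec P) (q? : Dec Q) → (P → Q) → (Q → P) → ⟦ p? ⟧ ≡ ⟦ q? ⟧
⟦⟧-cong (yes p) q? P→Q Q→P = sym (⟦⟧-yes q? (P→Q p))
⟦⟧-cong (no ¬p) q? P→Q Q→P = sym (⟦⟧-no q? (¬p ∘ Q→P))

module Multiplicity (_≟_ : DecidableEquality A) where

  count : A → List A → ℕ
  count x xs = ∑[ y ← xs ] ⟦ x ≟ y ⟧

  ∉⇒count≡0 : ∀ {x} xs → x ∉ xs → count x xs ≡ 0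
  ∉⇒count≡0 {x} xs x∉ = ∑-zero xs λ {y} y∈ → ⟦⟧-no (x ≟ y) λ { refl → x∉ y∈ }

  ∈⇒0<count : ∀ {x xs} → x ∈ xs → 0 < count x xs
  ∈⇒0<count {x} {xs} x∈ = begin-strict
    0              <⟨ n<1+n 0 ⟩
    1              ≡⟨ ⟦⟧-yes (x ≟ x) refl ⟨
    ⟦ x ≟ x ⟧      ≤⟨ ∑-∈-≤ (λ y → ⟦ x ≟ y ⟧) x∈ ⟩
    count x xs     ∎
    where open ≤-Reasoning

  0<count⇒∈ : ∀ {x} xs → 0 < count x xs → x ∈ xs
  0<count⇒∈ {x} xs 0< with any? (x ≟_) xs
  ... | yes x∈ = x∈
  ... | no x∉  = contradiction (∉⇒count≡0 xs x∉) (>⇒≢ 0<)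

  ∑-δ : ∀ {xs x} (f : A → ℕ) → Unique xs → x ∈ xs → (∑[ y ← xs ] (⟦ y ≟ x ⟧ * f y)) ≡ f x
  ∑-δ {xs} {x} f u x∈ = begin
    (∑[ y ← xs ] h y)       ≡⟨ +-identityʳ _ ⟨
    -- The indicator leaves a function that differs from the zero function only at `x`.
    ∑ xs h + 0              ≡⟨ ∑-exchange u x∈ (λ {y} y≢x → cong (_* f y) (⟦⟧-no (y ≟ x) y≢x)) ⟩
    (∑[ y ← xs ] 0) + h x   ≡⟨ cong₂ _+_ (∑-const xs 0) (cong (_* f x) (⟦⟧-yes (x ≟ x) refl)) ⟩
    1 * f x                 ≡⟨ *-identityˡ (f x) ⟩
    f x                     ∎
    where
    open ≡-Reasoning
    h : A → ℕ
    h y = ⟦ y ≟ x ⟧ * f y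

  Unique⇒count≤1 : ∀ {xs} → Unique xs → ∀ x → count x xs ≤ 1
  Unique⇒count≤1 {xs} u x with any? (x ≟_) xs
  ... | no x∉  = ≤-trans (≤-reflexive (∉⇒count≡0 xs x∉)) z≤n
  ... | yes x∈ = ≤-reflexive (begin
    count x xs                      ≡⟨ ∑-cong xs (λ {y} _ → trans (⟦⟧-cong (x ≟ y) (y ≟ x) sym sym) (sym (*-identityʳ _))) ⟩
    (∑[ y ← xs ] (⟦ y ≟ x ⟧ * 1))   ≡⟨ ∑-δ (const 1) u x∈ ⟩
    1                               ∎)
    where open ≡-Reasoning

  count≤1⇒Unique : ∀ xs → (∀ x → count x xs ≤ 1) → Unique xs
  count≤1⇒Unique []       c≤1 = []
  count≤1⇒Unique (x ∷ xs) c≤1 =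
    All.tabulate (λ {y} y∈ x≡y → <-irrefl refl (begin-strict
      1                        ≡⟨ ⟦⟧-yes (x ≟ x) refl ⟨
      ⟦ x ≟ x ⟧                <⟨ m<m+n _ (∈⇒0<count (subst (_∈ xs) (sym x≡y) y∈)) ⟩
      ⟦ x ≟ x ⟧ + count x xs   ≤⟨ c≤1 x ⟩
      1                        ∎))
    ∷ count≤1⇒Unique xs (λ y → ≤-trans (m≤n+m _ _) (c≤1 y))
    where open ≤-Reasoning

-- Augmenting assignments

module Transport {K : Set} (_≟_ : DecidableEquality K) {R : ℕ} (cs : List K) (w : Fin R → K → ℕ) where

  open import Data.List.Membership.DecPropositional _≟_ using (_∈?_)

  rows : List (Fin R)
  rows = allFin R

  Assignment : Set
  Assignment = Fin R → Maybe K

  _assigns_ : Maybe K → K → ℕ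
  m assigns c = ⟦ Maybe.≡-dec _≟_ m (just c) ⟧

  load : Assignment → K → ℕ
  load f c = ∑[ i ← rows ] (f i assigns c)

  Valid : Assignment → Set
  Valid f = ∀ i c → f i ≡ just c → c ∈ cs × 0 < w i c

  _[_≔_] : Assignment → Fin R → K → Assignment
  (f [ i ≔ c ]) j with j Fin.≟ i
  ... | yes _ = just c
  ... | no _  = f j

  ≔-updates : ∀ f i c → (f [ i ≔ c ]) i ≡ just c
  ≔-updates f i c with i Fin.≟ i
  ... | yes _  = refl
  ... | no i≢i = contradiction refl i≢i

  ≔-minimal : ∀ f {i j} c → j ≢ i → (f [ i ≔ c ]) j ≡ f j
  ≔-minimal f {i} {j} c j≢i with j Fin.≟ i
  ... | yes j≡i = contradiction j≡i j≢i
  ... | no _    = refl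

  ≔-valid : ∀ {f i c} → Valid f → c ∈ cs → 0 < w i c → Valid (f [ i ≔ c ])
  ≔-valid {f} {i} valid c∈ 0<w j c′ eq with j Fin.≟ i
  ≔-valid valid c∈ 0<w j c′ refl | yes refl = c∈ , 0<w
  ≔-valid valid c∈ 0<w j c′ eq   | no _     = valid j c′ eq

  load-≔ : ∀ f i c x → load (f [ i ≔ c ]) x + f i assigns x ≡ load f x + just c assigns x
  load-≔ f i c x = trans
    (∑-exchange (allFin⁺ R) (∈-allFin i) (λ j≢i → cong (_assigns x) (≔-minimal f c j≢i)))
    (cong (λ m → load f x + m assigns x) (≔-updates f i c))

  -- An unassigned row lies in no set of columns, so an edge to it always leaves the search set;
  -- this is how augmenting paths end.
  AssignedIn : List K → Maybe K → Set
  AssignedIn A = MAny.Any (_∈ A)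

  -- A unit of load can be moved from c to c₀, touching only rows assigned into A.
  Shift : Assignment → K → List K → K → Set
  Shift f c₀ A c = ∃ λ f′ → Valid f′ ×
    (∀ x → load f′ x + just c assigns x ≡ load f x + just c₀ assigns x) ×
    (∀ i → ¬ AssignedIn A (f i) → f′ i ≡ f i)

  Augmentation : Assignment → K → Set
  Augmentation f c₀ = ∃ λ f′ → Valid f′ × (∀ x → load f′ x ≡ load f x + just c₀ assigns x)

  Extension : Assignment → K → List K → Set
  Extension f c₀ A = ∃ λ c′ → c′ ∈ cs × c′ ∉ A × (∀ {c} → c ∈ c′ ∷ A → Shift f c₀ (c′ ∷ A) c)

  -- An edge by which the set A of columns reached from c₀ can be left.
  Exit : Assignment → List K → K → Fin R → Set
  Exit f A c i = 0 < w i c × ¬ AssignedIn A (f i)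

  exit? : ∀ f A → Dec (∃₂ λ c i → c ∈ A × Exit f A c i)
  exit? f A with any? (λ c → any? (λ i → (0 <? w i c) ×-dec ¬? (MAny.dec (_∈? A) (f i))) rows) A
  ... | yes p with c , c∈ , q ← find p with i , _ , e ← find q = yes (c , i , c∈ , e)
  ... | no ¬p = no λ (c , i , c∈ , e) → ¬p (lose c∈ (lose (∈-allFin i) e))

  -- Read `w i c` divided by `n` as the share of row `i` given to column `c`. The two hypotheses
  -- then describe a fractional assignment that uses no row more than once and serves `c` exactly
  -- `d c` times; the aim is an integral one on the same edges.
  module _ (n : ℕ) .{{_ : NonZero n}} (d : K → ℕ)
           (rowSum≤ : ∀ i → ∑ cs (w i) ≤ n)
           (colSum : ∀ {c} → c ∈ cs → (∑[ i ← rows ] w i c) ≡ n * d c) where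

    module _ {f : Assignment} (load≤d : ∀ {c} → c ∈ cs → load f c ≤ d c)
             {c₀ : K} (load<d : load f c₀ < d c₀) where

      -- Otherwise the columns in A carry the weight of more than all rows assigned to them.
      exit-exists : ∀ {A B} → cs ↭ A ++ B → c₀ ∈ A → ¬ ¬ (∃₂ λ c i → c ∈ A × Exit f A c i)
      exit-exists {A} {B} cs↭ c₀∈ closed = <-irrefl refl (begin-strict
        n * ∑ A d                                        ≡⟨ ∑-*ˡ A n d ⟨
        (∑[ c ← A ] (n * d c))                           ≡⟨ ∑-cong A (colSum ∘ A⊆cs) ⟨
        (∑[ c ← A ] ∑[ i ← rows ] w i c)                 ≡⟨ ∑-swap A rows (λ c i → w i c) ⟩
        (∑[ i ← rows ] ∑[ c ← A ] w i c)                 ≤⟨ ∑-mono-≤ rows (λ {i} _ → row i) ⟩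
        (∑[ i ← rows ] (n * (∑[ c ← A ] f i assigns c))) ≡⟨ ∑-*ˡ rows n _ ⟩
        n * (∑[ i ← rows ] ∑[ c ← A ] f i assigns c)     ≡⟨ cong (n *_) (∑-swap rows A (λ i → f i assigns_)) ⟩
        -- Strict because of `c₀`, whose load is below its demand.
        n * ∑ A (load f)                                 <⟨ *-monoʳ-< n (∑-mono-< c₀∈ (load≤d ∘ A⊆cs) load<d) ⟩
        n * ∑ A d                                        ∎)
        where
        open ≤-Reasoning
        A⊆cs : ∀ {c} → c ∈ A → c ∈ cs
        A⊆cs = ∈-resp-↭ (↭-sym cs↭) ∘ ∈-++⁺ˡ
        -- Positive weight on a column of `A` would make such a row an exit.
        unassigned : ∀ i → ¬ AssignedIn A (f i) → ∀ {c} → c ∈ A → w i c ≡ 0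
        unassigned i ¬a {c} c∈ with w i c in eq
        ... | zero  = refl
        ... | suc _ = ⊥-elim (closed (c , i , c∈ , subst (0 <_) (sym eq) (s≤s z≤n) , ¬a))
        -- A row assigned outside `A` has no weight on `A`; a row assigned into `A` has weight at
        -- most `n`, which its one unit of load pays for.
        row : ∀ i → ∑ A (w i) ≤ n * (∑[ c ← A ] f i assigns c)
        row i with f i | unassigned i
        ... | nothing | un = ≤-trans (≤-reflexive (∑-zero A (un λ ()))) z≤n
        ... | just c  | un with c ∈? A
        ...   | no c∉  = ≤-trans (≤-reflexive (∑-zero A (un λ { (MAny.just c∈) → c∉ c∈ }))) z≤n
        ...   | yes c∈ = begin
          ∑ A (w i)                             ≤⟨ m≤m+n _ _ ⟩
          ∑ A (w i) + ∑ B (w i)                 ≡⟨ ∑-++ A B (w i) ⟨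
          ∑ (A ++ B) (w i)                      ≡⟨ ∑-↭ (w i) cs↭ ⟨
          ∑ cs (w i)                            ≤⟨ rowSum≤ i ⟩
          n                                     ≡⟨ *-identityʳ n ⟨
          n * 1                                 ≡⟨ cong (n *_) (⟦⟧-yes (Maybe.≡-dec _≟_ (just c) (just c)) refl) ⟨
          n * (just c assigns c)                ≤⟨ *-monoʳ-≤ n (∑-∈-≤ (just c assigns_) c∈) ⟩
          n * (∑[ c′ ← A ] just c assigns c′)   ∎

      -- First a unit of load is shifted from `c` to `c₀`, then the exit row `i` is given to `c` in
      -- compensation. If `i` was unassigned, the net effect is one more unit at `c₀`; if it was
      -- assigned to `c′`, the unit at `c₀` comes from `c′`, which is thereby reached.
      extend : ∀ {A} → A ⊆ cs → Valid f → (∀ {c} → c ∈ A → Shift f c₀ A c) → (∃₂ λ c i → c ∈ A × Exit f A c i) →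
               Augmentation f c₀ ⊎ Extension f c₀ A
      extend {A} A⊆cs valid shifts (c , i , c∈ , 0<w , ¬a) with shifts c∈
      ... | g , g-valid , g-load , g-agrees = cases (f i) refl
        where
        h : Assignment
        h = g [ i ≔ c ]
        h-valid : Valid h
        h-valid = ≔-valid g-valid (A⊆cs c∈) 0<w
        h-load : ∀ x → load h x + f i assigns x ≡ load f x + just c₀ assigns x
        h-load x = begin
          -- The shift has not touched row `i`, which is not assigned into `A`.
          load h x + f i assigns x      ≡⟨ cong (λ m → load h x + m assigns x) (g-agrees i ¬a) ⟨
          load h x + g i assigns x      ≡⟨ load-≔ g i c x ⟩
          load g x + just c assigns x   ≡⟨ g-load x ⟩
          load f x + just c₀ assigns x  ∎
          where open ≡-Reasoning
        cases : ∀ m → f i ≡ m → Augmentation f c₀ ⊎ Extension f c₀ A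
        cases nothing fi =
          inj₁ (h , h-valid , λ x →
            trans (sym (+-identityʳ _)) (trans (cong (λ m → load h x + m assigns x) (sym fi)) (h-load x)))
        cases (just c′) fi =
          inj₂ (c′ , proj₁ (valid i c′ fi) , (λ c′∈ → ¬a (subst (AssignedIn A) (sym fi) (MAny.just c′∈))) , shifts′)
          where
          narrow : ∀ {m} → ¬ AssignedIn (c′ ∷ A) m → ¬ AssignedIn A m
          narrow ¬b (MAny.just x∈) = ¬b (MAny.just (there x∈))
          -- Row `i` is assigned to `c′`, hence differs from any row outside `c′ ∷ A`.
          h-agrees : ∀ j → ¬ AssignedIn (c′ ∷ A) (f j) → h j ≡ f j
          h-agrees j ¬b = trans
            (≔-minimal g c λ { refl → ¬b (subst (AssignedIn (c′ ∷ A)) (sym fi) (MAny.just (here refl))) })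
            (g-agrees j (narrow ¬b))
          shifts′ : ∀ {x} → x ∈ c′ ∷ A → Shift f c₀ (c′ ∷ A) x
          shifts′ (here refl) =
            h , h-valid , (λ x → trans (cong (λ m → load h x + m assigns x) (sym fi)) (h-load x)) , h-agrees
          shifts′ (there x∈) with k , k-valid , k-load , k-agrees ← shifts x∈ =
            k , k-valid , k-load , λ j ¬b → k-agrees j (narrow ¬b)

      -- `A` holds the columns reached and `B` the others. Every extension moves a column from `B`
      -- to `A`, so a bound on the length of `B` serves as fuel, and an augmentation must come
      -- before `B` runs out.
      explore : ∀ m {A B} → length B < m → cs ↭ A ++ B → c₀ ∈ A → Valid f →
                (∀ {c} → c ∈ A → Shift f c₀ A c) → Augmentation f c₀
      explore (suc m) {A} {B} (s≤s B≤m) cs↭ c₀∈ valid shifts with exit? f A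
      ... | no closed = contradiction closed (exit-exists cs↭ c₀∈)
      ... | yes e with extend (∈-resp-↭ (↭-sym cs↭) ∘ ∈-++⁺ˡ) valid shifts e
      ... | inj₁ augmentation = augmentation
      ... | inj₂ (c′ , c′∈cs , c′∉A , shifts′) with ∈-++⁻ A (∈-resp-↭ cs↭ c′∈cs)
      ... | inj₁ c′∈A = contradiction c′∈A c′∉A
      ... | inj₂ c′∈B with B₁ , B₂ , refl ← ∈-∃++ c′∈B =
        explore m
          (≤-trans (≤-reflexive (sym (Perm.↭-length (shift c′ B₁ B₂)))) B≤m)
          (↭-trans cs↭ (↭-trans (Perm.++⁺ˡ A (shift c′ B₁ B₂)) (shift c′ A (B₁ ++ B₂))))
          (there c₀∈) valid shifts′

      augment : c₀ ∈ cs → Valid f → Augmentation f c₀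
      augment c₀∈ valid with C₁ , C₂ , cs≡ ← ∈-∃++ c₀∈ =
        explore (suc (length (C₁ ++ C₂))) {[ c₀ ]} ≤-refl (subst (_↭ c₀ ∷ C₁ ++ C₂) (sym cs≡) (shift c₀ C₁ C₂))
          -- The search starts at `c₀` alone, where the unchanged `f` is a shift from `c₀` to
          -- itself.
          (here refl) valid λ { (here refl) → f , valid , (λ _ → refl) , λ _ _ → refl ; (there ()) }

    -- `m` bounds the load still missing. An augmentation at a column below its demand raises the
    -- total load and overfills no column; once `m` is 0, a deficient column would contradict the
    -- bound.
    fill : ∀ m f → Valid f → (∀ {c} → c ∈ cs → load f c ≤ d c) → ∑ cs d ≤ m + ∑ cs (load f) →
           ∃ λ f′ → Valid f′ × (∀ {c} → c ∈ cs → load f′ c ≡ d c)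
    fill m f valid load≤d ∑d≤ with any? (λ c → load f c <? d c) cs
    ... | no full = f , valid , λ c∈ → ≤-antisym (load≤d c∈) (≮⇒≥ (full ∘ lose c∈))
    ... | yes free with find free
    fill zero f valid load≤d ∑d≤ | yes _ | c₀ , c₀∈ , load<d =
      contradiction ∑d≤ (<⇒≱ (∑-mono-< c₀∈ load≤d load<d))
    fill (suc m) f valid load≤d ∑d≤ | yes _ | c₀ , c₀∈ , load<d
      with f′ , valid′ , load′ ← augment load≤d load<d c₀∈ valid =
      fill m f′ valid′ load′≤d ∑d≤′
      where
      open ≤-Reasoning
      load′≤d : ∀ {c} → c ∈ cs → load f′ c ≤ d c
      load′≤d {c} c∈ with c₀ ≟ c
      ... | yes refl = begin
        load f′ c₀                      ≡⟨ load′ c₀ ⟩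
        load f c₀ + just c₀ assigns c₀  ≡⟨ cong (load f c₀ +_) (⟦⟧-yes (Maybe.≡-dec _≟_ (just c₀) (just c₀)) refl) ⟩
        load f c₀ + 1                   ≡⟨ +-comm _ 1 ⟩
        suc (load f c₀)                 ≤⟨ load<d ⟩
        d c₀                            ∎
      ... | no c₀≢c = begin
        load f′ c                       ≡⟨ load′ c ⟩
        load f c + just c₀ assigns c    ≡⟨ cong (load f c +_) (⟦⟧-no (Maybe.≡-dec _≟_ (just c₀) (just c)) (c₀≢c ∘ just-injective)) ⟩
        load f c + 0                    ≡⟨ +-identityʳ _ ⟩
        load f c                        ≤⟨ load≤d c∈ ⟩
        d c                             ∎
      ∑d≤′ : ∑ cs d ≤ m + ∑ cs (load f′)
      ∑d≤′ = begin
        ∑ cs d                                            ≤⟨ ∑d≤ ⟩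
        suc m + ∑ cs (load f)                             ≡⟨ +-suc m _ ⟨
        m + suc (∑ cs (load f))                           ≤⟨ +-monoʳ-≤ m (∑-mono-< c₀∈ (λ {c} _ → ≤-trans (m≤m+n _ _) (≤-reflexive (sym (load′ c)))) grows) ⟩
        m + ∑ cs (load f′)                                ∎
        where
        grows : load f c₀ < load f′ c₀
        grows = begin-strict
          load f c₀                       <⟨ m<m+n _ (≤-reflexive (sym (⟦⟧-yes (Maybe.≡-dec _≟_ (just c₀) (just c₀)) refl))) ⟩
          load f c₀ + just c₀ assigns c₀  ≡⟨ load′ c₀ ⟨
          load f′ c₀                      ∎

    -- No row stays unassigned: the column capacities add up to the number of rows, and Unique forbids overcounting.
    transport : Unique cs → (∀ i → ∑ cs (w i) ≡ n) →
                ∃ λ (f : Fin R → K) → (∀ i → f i ∈ cs × 0 < w i (f i)) ×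
                  (∀ {c} → c ∈ cs → (∑[ i ← rows ] ⟦ f i ≟ c ⟧) ≡ d c)
    transport unique rowSum
      -- All rows start unassigned, so the total demand bounds what is missing.
      with f , valid , load≡d ← fill (∑ cs d) (const nothing) (λ _ _ ())
                                  (λ {c} _ → ≤-trans (≤-reflexive (∑-zero rows (λ _ → refl))) z≤n) (m≤m+n _ _) =
      (λ i → proj₁ (total i)) , (λ i → valid i _ (proj₂ (total i))) ,
      λ {c} c∈ → trans (∑-cong rows (λ {i} _ → trans
          (⟦⟧-cong (proj₁ (total i) ≟ c) (Maybe.≡-dec _≟_ (just _) (just c)) (cong just) just-injective)
          (cong (_assigns c) (sym (proj₂ (total i))))))
        (load≡d c∈)
      where
      open ≤-Reasoning
      open Multiplicity _≟_
      -- Multiplied by `n`, both sides are the total weight, summed by columns and by rows.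
      ∑d≡R : ∑ cs d ≡ length rows
      ∑d≡R = *-cancelˡ-≡ _ _ n (begin-equality
        n * ∑ cs d                          ≡⟨ ∑-*ˡ cs n d ⟨
        (∑[ c ← cs ] (n * d c))             ≡⟨ ∑-cong cs colSum ⟨
        (∑[ c ← cs ] ∑[ i ← rows ] w i c)   ≡⟨ ∑-swap cs rows (λ c i → w i c) ⟩
        (∑[ i ← rows ] ∑ cs (w i))          ≡⟨ ∑-cong rows (λ {i} _ → rowSum i) ⟩
        (∑[ i ← rows ] n)                   ≡⟨ ∑-const rows n ⟩
        n * length rows                     ∎)
      row≤1 : ∀ m → (∑[ c ← cs ] m assigns c) ≤ 1
      row≤1 nothing  = ≤-trans (≤-reflexive (∑-zero cs (λ _ → refl))) z≤n
      row≤1 (just x) = ≤-trans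
        (≤-reflexive (∑-cong cs λ {c} _ → ⟦⟧-cong (Maybe.≡-dec _≟_ (just x) (just c)) (x ≟ c) just-injective (cong just)))
        (Unique⇒count≤1 unique x)
      total : ∀ i → ∃ λ c → f i ≡ just c
      total i with f i in fi
      ... | just c  = c , refl
      ... | nothing = ⊥-elim (<-irrefl refl (begin-strict
        ∑ cs d                                       ≡⟨ ∑-cong cs load≡d ⟨
        ∑ cs (load f)                                ≡⟨ ∑-swap cs rows (λ c j → f j assigns c) ⟩
        (∑[ j ← rows ] ∑[ c ← cs ] f j assigns c)    <⟨ ∑-mono-< (∈-allFin i) (λ {j} _ → row≤1 (f j)) row<1 ⟩
        (∑[ j ← rows ] 1)                            ≡⟨ ∑-const rows 1 ⟩
        1 * length rows                              ≡⟨ *-identityˡ _ ⟩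
        length rows                                  ≡⟨ ∑d≡R ⟨
        ∑ cs d                                       ∎))
        where
        row<1 : (∑[ c ← cs ] f i assigns c) < 1
        row<1 = s≤s (≤-reflexive (∑-zero cs (λ {c} _ → cong (_assigns c) fi)))

-- Rows may have slack, which is turned into the weight of an additional column.
round : ∀ {K : Set} (_≟_ : DecidableEquality K) {R} {cs : List K} (w : Fin R → K → ℕ) n .{{_ : NonZero n}} (d : K → ℕ) →
        Unique cs → (∀ i → ∑ cs (w i) ≤ n) → (∀ {c} → c ∈ cs → (∑[ i ← allFin R ] w i c) ≡ n * d c) →
        ∃ λ (f : Fin R → Maybe K) →
          (∀ i c → f i ≡ just c → c ∈ cs × 0 < w i c) ×
          (∀ i → f i ≡ nothing → ∑ cs (w i) < n) ×
          (∀ {c} → c ∈ cs → (∑[ i ← allFin R ] ⟦ Maybe.≡-dec _≟_ (f i) (just c) ⟧) ≡ d c)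
round {K} _≟_ {R} {cs} w n d unique rowSum≤ colSum =
  let f , valid , load = transport n d⁺ (≤-reflexive ∘ rowSum⁺) colSum⁺ unique⁺ rowSum⁺ in
  f , (λ i c fi → just-valid (subst (λ m → m ∈ cs⁺ × 0 < w⁺ i m) fi (valid i))) ,
  -- A row sent to the additional column has positive weight there, that is, positive slack.
  (λ i fi → m∸n≢0⇒n<m (>⇒≢ (subst (λ m → 0 < w⁺ i m) fi (proj₂ (valid i))))) ,
  λ c∈ → load (there (∈-map⁺ just c∈))
  where
  cs⁺ : List (Maybe K)
  cs⁺ = nothing ∷ map just cs
  w⁺ : Fin R → Maybe K → ℕ
  w⁺ i nothing  = n ∸ ∑ cs (w i)
  w⁺ i (just c) = w i c
  d⁺ : Maybe K → ℕ
  -- The additional column takes all rows that `cs` does not need.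
  d⁺ nothing  = R ∸ ∑ cs d
  d⁺ (just c) = d c
  open Transport (Maybe.≡-dec _≟_) cs⁺ w⁺
  just-valid : ∀ {i c} → just c ∈ cs⁺ × 0 < w⁺ i (just c) → c ∈ cs × 0 < w i c
  just-valid (there c∈ , 0<w) with _ , c∈′ , refl ← ∈-map⁻ just c∈ = c∈′ , 0<w
  unique⁺ : Unique cs⁺
  unique⁺ = All.map⁺ (All.tabulate (λ _ ())) ∷ Unique.map⁺ just-injective unique
  rowSum⁺ : ∀ i → ∑ cs⁺ (w⁺ i) ≡ n
  rowSum⁺ i = trans (cong (w⁺ i nothing +_) (∑-map just cs (w⁺ i))) (m∸n+n≡m (rowSum≤ i))
  colSum⁺ : ∀ {m} → m ∈ cs⁺ → (∑[ i ← rows ] w⁺ i m) ≡ n * d⁺ m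
  colSum⁺ (there m∈) with _ , c∈ , refl ← ∈-map⁻ just m∈ = colSum c∈
  colSum⁺ (here refl) = begin
    slack                          ≡⟨ m+n∸n≡m slack (n * ∑ cs d) ⟨
    slack + n * ∑ cs d ∸ n * ∑ cs d ≡⟨ cong (_∸ n * ∑ cs d) mass ⟩
    n * R ∸ n * ∑ cs d             ≡⟨ *-distribˡ-∸ n R (∑ cs d) ⟨
    n * (R ∸ ∑ cs d)               ∎
    where
    open ≡-Reasoning
    slack : ℕ
    slack = ∑[ i ← rows ] (n ∸ ∑ cs (w i))
    -- Each row weighs exactly `n` once its slack is counted. So the total slack is the multiple of
    -- `n` that the additional column demands, and the subtraction in `d⁺` is not truncated.
    mass : slack + n * ∑ cs d ≡ n * R
    mass = begin
      slack + n * ∑ cs d                               ≡⟨ cong (slack +_) (∑-*ˡ cs n d) ⟨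
      slack + (∑[ c ← cs ] (n * d c))                  ≡⟨ cong (slack +_) (∑-cong cs colSum) ⟨
      slack + (∑[ c ← cs ] ∑[ i ← rows ] w i c)        ≡⟨ cong (slack +_) (∑-swap cs rows (λ c i → w i c)) ⟩
      slack + (∑[ i ← rows ] ∑ cs (w i))               ≡⟨ ∑-+ rows _ _ ⟨
      (∑[ i ← rows ] (n ∸ ∑ cs (w i) + ∑ cs (w i)))    ≡⟨ ∑-cong rows (λ {i} _ → m∸n+n≡m (rowSum≤ i)) ⟩
      (∑[ i ← rows ] n)                                ≡⟨ ∑-const rows n ⟩
      n * length rows                                  ≡⟨ cong (n *_) (length-tabulate {n = R} (λ i → i)) ⟩
      n * R                                            ∎

-- Binomial coefficients and subsets

nC0≡1 : ∀ n → n C 0 ≡ 1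
nC0≡1 n = trans (nCk≡nC[n∸k] {0} {n} z≤n) (nCn≡1 n)

-- Both sides count the subsets of size `suc k` with a marked element; the proof is by Pascal's
-- rule. It makes the expected number of blocks of a class taking the next element an integer.
absorption : ∀ n k → suc k * (suc n C suc k) ≡ suc n * (n C k)
absorption zero    zero    = refl
absorption zero    (suc k) = *-zeroʳ (suc (suc k))
absorption (suc n) zero    = begin
  1 * (suc (suc n) C 1)      ≡⟨ *-identityˡ _ ⟩
  suc (suc n) C 1            ≡⟨ nC1≡n (suc (suc n)) ⟩
  suc (suc n)                ≡⟨ *-identityʳ _ ⟨
  suc (suc n) * 1            ≡⟨ cong (suc (suc n) *_) (nC0≡1 (suc n)) ⟨
  suc (suc n) * (suc n C 0)  ∎
  where open ≡-Reasoning
absorption (suc n) (suc k) = begin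
  suc (suc k) * (suc (suc n) C suc (suc k))  ≡⟨ cong (suc (suc k) *_) (nCk+nC[k+1]≡[n+1]C[k+1] (suc n) (suc k)) ⟨
  suc (suc k) * (a + b)                      ≡⟨ expand k a b ⟩
  a + (suc k * a + suc (suc k) * b)          ≡⟨ cong (a +_) (cong₂ _+_ (absorption n k) (absorption n (suc k))) ⟩
  a + (suc n * (n C k) + suc n * (n C suc k)) ≡⟨ cong (a +_) (*-distribˡ-+ (suc n) (n C k) (n C suc k)) ⟨
  a + suc n * (n C k + n C suc k)            ≡⟨ cong (λ x → a + suc n * x) (nCk+nC[k+1]≡[n+1]C[k+1] n k) ⟩
  suc (suc n) * a                            ∎
  where
  open ≡-Reasoning
  a b : ℕ
  a = suc n C suc k
  b = suc n C suc (suc k)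
  expand : ∀ k a b → suc (suc k) * (a + b) ≡ a + (suc k * a + suc (suc k) * b)
  expand = solve-∀

subsets : ∀ ℓ → List (Subset ℓ)
subsets zero    = [] ∷ []
subsets (suc ℓ) = map (outside ∷_) (subsets ℓ) ++ map (inside ∷_) (subsets ℓ)

∈-subsets : ∀ {ℓ} (S : Subset ℓ) → S ∈ subsets ℓ
∈-subsets []            = here refl
∈-subsets (outside ∷ S) = ∈-++⁺ˡ (∈-map⁺ _ (∈-subsets S))
∈-subsets (inside ∷ S)  = ∈-++⁺ʳ _ (∈-map⁺ _ (∈-subsets S))

subsets-unique : ∀ ℓ → Unique (subsets ℓ)
subsets-unique zero    = [] ∷ []
subsets-unique (suc ℓ) = Unique.++⁺
  (Unique.map⁺ Vec.∷-injectiveʳ (subsets-unique ℓ)) (Unique.map⁺ Vec.∷-injectiveʳ (subsets-unique ℓ)) disjoint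
  where
  disjoint : ∀ {S} → S ∈ map (outside ∷_) (subsets ℓ) × S ∈ map (inside ∷_) (subsets ℓ) → ⊥
  disjoint (S∈ , S∈′) with _ , _ , refl ← ∈-map⁻ _ S∈ | _ , _ , () ← ∈-map⁻ _ S∈′

disjoint-outsideˡ : ∀ {ℓ x} {S T : Subset ℓ} → Disjoint S T → Disjoint (outside ∷ S) (x ∷ T)
disjoint-outsideˡ S∩T=∅ (suc i , there i∈) = S∩T=∅ (i , i∈)

disjoint-outsideʳ : ∀ {ℓ x} {S T : Subset ℓ} → Disjoint S T → Disjoint (x ∷ S) (outside ∷ T)
disjoint-outsideʳ {x = inside}  S∩T=∅ (suc i , there i∈) = S∩T=∅ (i , i∈)
disjoint-outsideʳ {x = outside} S∩T=∅ (suc i , there i∈) = S∩T=∅ (i , i∈)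

-- Growing a system one element at a time

-- (k , S) stands for a member of the system whose trace on the elements seen so far is S and which
-- is still to receive k of the remaining elements.
Block : ℕ → Set
Block ℓ = ℕ × Subset ℓ

size : ∀ {ℓ} → Block ℓ → ℕ
size (k , S) = ∣ S ∣ + k

_≟ₛ_ : ∀ {ℓ} → DecidableEquality (Subset ℓ)
_≟ₛ_ = Vec.≡-dec Bool._≟_

_≟ᵇ_ : ∀ {ℓ} → DecidableEquality (Block ℓ)
_≟ᵇ_ = Product.≡-dec _≟_ _≟ₛ_

module SubsetMultiplicity {ℓ} = Multiplicity (_≟ₛ_ {ℓ})
open module BlockMultiplicity {ℓ} = Multiplicity (_≟ᵇ_ {ℓ})

_chooses_ : ∀ {ℓ} → Maybe (Block ℓ) → Block ℓ → ℕ
m chooses b = ⟦ Maybe.≡-dec _≟ᵇ_ m (just b) ⟧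

just-chooses : ∀ {ℓ} (b c : Block ℓ) → just b chooses c ≡ ⟦ b ≟ᵇ c ⟧
just-chooses b c = ⟦⟧-cong (Maybe.≡-dec _≟ᵇ_ (just b) (just c)) (b ≟ᵇ c) just-injective (cong just)

BlockDisjoint : ∀ {ℓ} → Block ℓ → Block ℓ → Set
BlockDisjoint (_ , S) (_ , T) = Disjoint S T

-- `join` is applied to blocks of positive need only, so `pred` never truncates.
omit join : ∀ {ℓ} → Block ℓ → Block (suc ℓ)
omit (k , S) = k , outside ∷ S
join (k , S) = pred k , inside ∷ S

count-omit-outside : ∀ {ℓ} k S (bs : List (Block ℓ)) → count (k , outside ∷ S) (map omit bs) ≡ count (k , S) bs
count-omit-outside k S bs = trans (∑-map omit bs _) (∑-cong bs λ {b} _ →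
  ⟦⟧-cong ((k , outside ∷ S) ≟ᵇ omit b) ((k , S) ≟ᵇ b) (λ { refl → refl }) (λ { refl → refl }))

count-omit-inside : ∀ {ℓ} k S (bs : List (Block ℓ)) → count (k , inside ∷ S) (map omit bs) ≡ 0
count-omit-inside k S bs = trans (∑-map omit bs _) (∑-zero bs λ {b} _ →
  ⟦⟧-no ((k , inside ∷ S) ≟ᵇ omit b) λ ())

omit-spread : ∀ {ℓ} {bs : List (Block ℓ)} → AllPairs BlockDisjoint bs → AllPairs BlockDisjoint (map omit bs)
omit-spread []         = []
omit-spread (b# ∷ bs#) = All.map⁺ (All.map (disjoint-outsideˡ {x = outside}) b#) ∷ omit-spread bs#

-- A row after the next element has been added to the chosen block, if any.
record Successor {ℓ} (n : ℕ) (bs : List (Block ℓ)) (m : Maybe (Block ℓ)) : Set where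
  field
    next    : List (Block (suc ℓ))
    sizes   : map size next ≡ map size bs
    budget  : ∑ next proj₁ ≤ n
    spread  : AllPairs BlockDisjoint next
    -- A block of class `(k , S)` omits the element unless it is the chosen one.
    omitted : ∀ k S → count (k , outside ∷ S) next + m chooses (k , S) ≡ count (k , S) bs
    -- Only the chosen block contains the element, and its need was one larger before.
    joined  : ∀ k S → count (k , inside ∷ S) next ≡ m chooses (suc k , S)

module _ {ℓ k : ℕ} {S : Subset ℓ} where

  private
    c : Block ℓ
    c = suc k , S

  -- A row can contain equal blocks, for instance with empty trace. Recursion on the membership
  -- proof selects a single occurrence to take the element.
  admit : ∀ {bs} → c ∈ bs → List (Block (suc ℓ))
  admit {_ ∷ bs} (here _)   = join c ∷ map omit bs
  admit {b ∷ bs} (there c∈) = omit b ∷ admit c∈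

  admit-sizes : ∀ {bs} (c∈ : c ∈ bs) → map size (admit c∈) ≡ map size bs
  admit-sizes {_ ∷ bs} (here refl) = cong₂ _∷_ (sym (+-suc ∣ S ∣ k)) (sym (map-∘ bs))
  admit-sizes {b ∷ bs} (there c∈)  = cong (size b ∷_) (admit-sizes c∈)

  admit-budget : ∀ {bs} (c∈ : c ∈ bs) → suc (∑ (admit c∈) proj₁) ≡ ∑ bs proj₁
  admit-budget {_ ∷ bs} (here refl) = cong (λ x → suc (k + x)) (∑-map omit bs proj₁)
  admit-budget {b ∷ bs} (there c∈)  = trans (sym (+-suc (proj₁ b) _)) (cong (proj₁ b +_) (admit-budget c∈))

  admit-disjoint : ∀ {b bs} (c∈ : c ∈ bs) → All (BlockDisjoint b) bs → All (BlockDisjoint (omit b)) (admit c∈)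
  admit-disjoint     (here refl) (b#c ∷ b#) = disjoint-outsideˡ {x = inside} b#c ∷ All.map⁺ (All.map (disjoint-outsideˡ {x = outside}) b#)
  admit-disjoint {b} (there c∈) (b#x ∷ b#) = disjoint-outsideˡ {x = outside} b#x ∷ admit-disjoint {b} c∈ b#

  admit-spread : ∀ {bs} (c∈ : c ∈ bs) → AllPairs BlockDisjoint bs → AllPairs BlockDisjoint (admit c∈)
  admit-spread         (here refl) (c# ∷ bs#) = All.map⁺ (All.map (disjoint-outsideʳ {x = inside}) c#) ∷ omit-spread bs#
  admit-spread {b ∷ _} (there c∈) (b# ∷ bs#) = admit-disjoint {b} c∈ b# ∷ admit-spread c∈ bs#

  admit-omitted : ∀ {bs} (c∈ : c ∈ bs) j T →
                  count (j , outside ∷ T) (admit c∈) + ⟦ c ≟ᵇ (j , T) ⟧ ≡ count (j , T) bs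
  admit-omitted {_ ∷ bs} (here refl) j T = begin
    ⟦ (j , outside ∷ T) ≟ᵇ join c ⟧ + count (j , outside ∷ T) (map omit bs) + ⟦ c ≟ᵇ (j , T) ⟧
      ≡⟨ cong₂ _+_ (cong₂ _+_ (⟦⟧-no ((j , outside ∷ T) ≟ᵇ join c) λ ()) (count-omit-outside j T bs))
           (⟦⟧-cong (c ≟ᵇ (j , T)) ((j , T) ≟ᵇ c) sym sym) ⟩
    count (j , T) bs + ⟦ (j , T) ≟ᵇ c ⟧
      ≡⟨ +-comm _ ⟦ (j , T) ≟ᵇ c ⟧ ⟩
    ⟦ (j , T) ≟ᵇ c ⟧ + count (j , T) bs ∎
    where open ≡-Reasoning
  admit-omitted {b ∷ bs} (there c∈) j T = trans (+-assoc ⟦ (j , outside ∷ T) ≟ᵇ omit b ⟧ _ _) (cong₂ _+_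
    (⟦⟧-cong ((j , outside ∷ T) ≟ᵇ omit b) ((j , T) ≟ᵇ b) (λ { refl → refl }) (λ { refl → refl }))
    (admit-omitted c∈ j T))

  admit-joined : ∀ {bs} (c∈ : c ∈ bs) j T → count (j , inside ∷ T) (admit c∈) ≡ ⟦ c ≟ᵇ (suc j , T) ⟧
  admit-joined {_ ∷ bs} (here refl) j T = trans
    (cong₂ _+_
      (⟦⟧-cong ((j , inside ∷ T) ≟ᵇ join c) (c ≟ᵇ (suc j , T)) (λ { refl → refl }) (λ { refl → refl }))
      (count-omit-inside j T bs))
    (+-identityʳ _)
  admit-joined {b ∷ bs} (there c∈) j T =
    cong₂ _+_ (⟦⟧-no ((j , inside ∷ T) ≟ᵇ omit b) λ ()) (admit-joined c∈ j T)

-- The needs fit into the `n` elements left in either case: a chosen block uses up one unit of need,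
-- and a row without a chosen block had a unit to spare.
successor : ∀ {ℓ n} {bs : List (Block ℓ)} m → AllPairs BlockDisjoint bs → ∑ bs proj₁ ≤ suc n →
            (∀ c → m ≡ just c → c ∈ bs × 0 < proj₁ c) → (m ≡ nothing → ∑ bs proj₁ < suc n) → Successor n bs m
successor {bs = bs} nothing spread _ _ budget = record
  { next    = map omit bs
  ; sizes   = sym (map-∘ bs)
  ; budget  = ≤-trans (≤-reflexive (∑-map omit bs proj₁)) (≤-pred (budget refl))
  ; spread  = omit-spread spread
  ; omitted = λ k S → trans (+-identityʳ _) (count-omit-outside k S bs)
  ; joined  = λ k S → count-omit-inside k S bs
  }
successor (just c) spread budget chosen _ with chosen c refl
successor (just (suc k , S)) spread budget chosen _ | c∈ , _ = record
  { next    = admit c∈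
  ; sizes   = admit-sizes c∈
  ; budget  = ≤-pred (≤-trans (≤-reflexive (admit-budget c∈)) budget)
  ; spread  = admit-spread c∈ spread
  ; omitted = λ j T → trans (cong (count (j , outside ∷ T) (admit c∈) +_) (just-chooses (suc k , S) (j , T)))
                            (admit-omitted c∈ j T)
  ; joined  = λ j T → trans (admit-joined c∈ j T) (sym (just-chooses (suc k , S) (suc j , T)))
  }

-- `complete` is the invariant that drives the induction: `n C k` is the number of ways to extend
-- the trace `S` by `k` of the `n` elements left, so there are as many blocks as sets they could
-- become.
record System (n ℓ : ℕ) {R} (M : Fin R → Shape) : Set where
  field
    row      : Fin R → List (Block ℓ)
    sizes    : ∀ i → map size (row i) ≡ M i
    budget   : ∀ i → ∑ (row i) proj₁ ≤ n
    spread   : ∀ i → AllPairs BlockDisjoint (row i)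
    complete : ∀ {k} S → k ≤ n → (∑[ i ← allFin R ] count (k , S) (row i)) ≡ n C k

advance : ∀ {n ℓ R} {M : Fin R → Shape} → System (suc n) ℓ M → System n (suc ℓ) M
advance {n} {ℓ} {R} {M} 𝒮 =
  let choice , chosen , slack , choices = round _≟ᵇ_ w (suc n) d unique (≤-trans (≤-reflexive (rowSum _)) ∘ budget) colSum in
  build choice chosen slack choices
  where
  open System 𝒮
  cs : List (Block ℓ)
  -- Needs from 0 to `suc n`, both included.
  cs = cartesianProduct (upTo (suc (suc n))) (subsets ℓ)
  unique : Unique cs
  unique = Unique.cartesianProduct⁺ (Unique.upTo⁺ (suc (suc n))) (subsets-unique ℓ)
  ∈-cs : ∀ {k} S → k ≤ suc n → (k , S) ∈ cs
  ∈-cs S k≤ = ∈-cartesianProduct⁺ (∈-upTo⁺ (s≤s k≤)) (∈-subsets S)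
  -- Divided by `suc n`, this is the expected number of blocks of class `c` in row `i` that take the
  -- next element.
  w : Fin R → Block ℓ → ℕ
  w i c = count c (row i) * proj₁ c
  -- The number of blocks of each class that must take the element to keep `complete` true for
  -- traces containing it; a block without need never does.
  d : Block ℓ → ℕ
  d (zero  , _) = 0
  d (suc k , _) = n C k
  rowSum : ∀ i → ∑ cs (w i) ≡ ∑ (row i) proj₁
  rowSum i = begin
    (∑[ c ← cs ] (count c (row i) * proj₁ c))             ≡⟨ ∑-cong cs (λ {c} _ → ∑-*ʳ (row i) (proj₁ c) _) ⟨
    (∑[ c ← cs ] ∑[ b ← row i ] (⟦ c ≟ᵇ b ⟧ * proj₁ c))   ≡⟨ ∑-swap cs (row i) (λ c b → ⟦ c ≟ᵇ b ⟧ * proj₁ c) ⟩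
    (∑[ b ← row i ] ∑[ c ← cs ] (⟦ c ≟ᵇ b ⟧ * proj₁ c))
      -- The budget bounds every need by `suc n`, so the class of each block occurs in `cs`, once.
      ≡⟨ ∑-cong (row i) (λ {b} b∈ → ∑-δ proj₁ unique (∈-cs (proj₂ b) (≤-trans (∑-∈-≤ proj₁ b∈) (budget i)))) ⟩
    ∑ (row i) proj₁                                       ∎
    where open ≡-Reasoning
  colSum : ∀ {c} → c ∈ cs → (∑[ i ← allFin R ] w i c) ≡ suc n * d c
  colSum {k , S} c∈ = trans (∑-*ʳ (allFin R) k _) (trans (cong (_* k) (complete S k≤)) (multiply k))
    where
    k≤ : k ≤ suc n
    k≤ = ≤-pred (∈-upTo⁻ (proj₁ (∈-cartesianProduct⁻ (upTo (suc (suc n))) (subsets ℓ) c∈)))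
    multiply : ∀ k → (suc n C k) * k ≡ suc n * d (k , S)
    multiply zero    = trans (*-zeroʳ (suc n C 0)) (sym (*-zeroʳ (suc n)))
    multiply (suc k) = trans (*-comm (suc n C suc k) (suc k)) (absorption n k)
  pascal : ∀ k S → n C k + d (k , S) ≡ suc n C k
  pascal zero    S = trans (+-identityʳ _) (trans (nC0≡1 n) (sym (nC0≡1 (suc n))))
  pascal (suc k) S = trans (+-comm (n C suc k) (n C k)) (nCk+nC[k+1]≡[n+1]C[k+1] n k)

  build : (choice : Fin R → Maybe (Block ℓ)) →
          (∀ i c → choice i ≡ just c → c ∈ cs × 0 < w i c) →
          (∀ i → choice i ≡ nothing → ∑ cs (w i) < suc n) →
          (∀ {c} → c ∈ cs → (∑[ i ← allFin R ] choice i chooses c) ≡ d c) → System n (suc ℓ) M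
  build choice chosen slack choices = record
    { row      = next ∘ successors
    ; sizes    = λ i → trans (Successor.sizes (successors i)) (sizes i)
    ; budget   = Successor.budget ∘ successors
    ; spread   = Successor.spread ∘ successors
    ; complete = complete′
    }
    where
    open Successor using (next; omitted; joined)
    open ≡-Reasoning
    member : ∀ i c → 0 < w i c → c ∈ row i × 0 < proj₁ c
    member i (zero  , S) 0<w = contradiction (*-zeroʳ (count (zero , S) (row i))) (>⇒≢ 0<w)
    member i (suc k , S) 0<w with count (suc k , S) (row i) in eq
    ... | suc _ = 0<count⇒∈ (row i) (subst (0 <_) (sym eq) (s≤s z≤n)) , s≤s z≤n
    successors : ∀ i → Successor n (row i) (choice i)
    successors i = successor (choice i) (spread i) (budget i)
      (λ c eq → member i c (proj₂ (chosen i c eq)))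
      (λ eq → subst (_< suc n) (rowSum i) (slack i eq))
    complete′ : ∀ {k} S → k ≤ n → (∑[ i ← allFin R ] count (k , S) (next (successors i))) ≡ n C k
    complete′ {k} (inside ∷ S) k≤ = begin
      (∑[ i ← allFin R ] count (k , inside ∷ S) (next (successors i)))
        ≡⟨ ∑-cong (allFin R) (λ {i} _ → joined (successors i) k S) ⟩
      (∑[ i ← allFin R ] choice i chooses (suc k , S))
        ≡⟨ choices (∈-cs S (s≤s k≤)) ⟩
      n C k ∎
    -- The blocks that omit the element are those of the old class minus the `d (k , S)` that took
    -- it; Pascal's rule leaves `n C k`.
    complete′ {k} (outside ∷ S) k≤ = +-cancelʳ-≡ (d (k , S)) _ _ (begin
      (∑[ i ← allFin R ] kept i) + d (k , S)
        ≡⟨ cong ((∑[ i ← allFin R ] kept i) +_) (choices (∈-cs S (m≤n⇒m≤1+n k≤))) ⟨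
      (∑[ i ← allFin R ] kept i) + (∑[ i ← allFin R ] choice i chooses (k , S))
        ≡⟨ ∑-+ (allFin R) kept _ ⟨
      (∑[ i ← allFin R ] (kept i + choice i chooses (k , S)))
        ≡⟨ ∑-cong (allFin R) (λ {i} _ → omitted (successors i) k S) ⟩
      (∑[ i ← allFin R ] count (k , S) (row i))
        ≡⟨ complete S (m≤n⇒m≤1+n k≤) ⟩
      suc n C k
        ≡⟨ pascal k S ⟨
      n C k + d (k , S) ∎)
      where
      kept : Fin R → ℕ
      kept i = count (k , outside ∷ S) (next (successors i))

exhaust : ∀ n {ℓ N R} {M : Fin R → Shape} → n + ℓ ≡ N → System n ℓ M → System 0 N M
exhaust zero    refl 𝒮 = 𝒮
exhaust (suc n) eq   𝒮 = exhaust n (trans (+-suc n _) eq) (advance 𝒮)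

-- The initial and the final system

μ≡∑ : ∀ M x → μ M x ≡ (∑[ y ← M ] ⟦ x ≟ y ⟧)
μ≡∑ []      x = refl
μ≡∑ (y ∷ M) x with does (x ≟ y)
... | true  = cong suc (μ≡∑ M x)
... | false = μ≡∑ M x

-- Before any element is handed out the only trace is the empty one and each entry is its own need,
-- so completeness is the assumed equality.
initial : ∀ {N R} (M : Fin R → Shape) → (∀ i → IsShape N (M i)) →
          (∀ k → k ≤ N → (∑[ i ← allFin R ] μ (M i) k) ≡ N C k) → System N 0 M
initial {N} {R} M shapes total = record
  { row      = λ i → map (_, []) (M i)
  ; sizes    = λ i → trans (sym (map-∘ (M i))) (map-id (M i))
  ; budget   = λ i → subst (_≤ N) (sym (trans (∑-map (_, []) (M i) proj₁) (cong sum (map-id (M i))))) (shapes i)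
  ; spread   = λ i → empties (M i)
  ; complete = λ { {k} [] k≤ → trans (∑-cong (allFin R) (λ {i} _ → counts (M i) k)) (total k k≤) }
  }
  where
  empties : ∀ L → AllPairs BlockDisjoint (map (_, []) L)
  empties []      = []
  empties (x ∷ L) = All.map⁺ (All.tabulate (λ { _ (() , _) })) ∷ empties L
  counts : ∀ L k → count (k , []) (map (_, []) L) ≡ μ L k
  counts L k = trans (∑-map (_, []) L _) (trans
    (∑-cong L (λ {x} _ → ⟦⟧-cong ((k , []) ≟ᵇ (x , [])) (k ≟ x) (cong proj₁) (cong (_, []))))
    (sym (μ≡∑ L k)))

-- The budget 0 forces every need to be 0, so each trace already has its prescribed size, and
-- `complete` for `k` equal to 0 bounds its multiplicity by 1.
final : ∀ {N} T → System 0 N (lookup T) → Realizable N T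
final {N} T 𝒮 = tabulate spreads ,
  (SubsetMultiplicity.count≤1⇒Unique _ once , All.tabulate⁺ (λ i → AllPairs.map⁺ (spread i))) ,
  subst (Pointwise (λ Us M → shapeOf Us ↭ M) (tabulate spreads)) (tabulate-lookup T) (Pointwise.tabulate⁺ shape)
  where
  open System 𝒮
  R : ℕ
  R = length T
  spreads : Fin R → List (Subset N)
  spreads i = map proj₂ (row i)
  finished : ∀ i {b} → b ∈ row i → proj₁ b ≡ 0
  finished i b∈ = n≤0⇒n≡0 (≤-trans (∑-∈-≤ proj₁ b∈) (budget i))
  shape : ∀ i → shapeOf (spreads i) ↭ lookup T i
  shape i = ↭-reflexive (trans (trans (sym (map-∘ (row i))) (map-cong-local (All.tabulate λ {b} b∈ →
    sym (trans (cong (∣ proj₂ b ∣ +_) (finished i b∈)) (+-identityʳ _))))) (sizes i))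
  once : ∀ S → SubsetMultiplicity.count S (concat (tabulate spreads)) ≤ 1
  once S = begin
    ∑ (concat (tabulate spreads)) (λ U → ⟦ S ≟ₛ U ⟧)
      ≡⟨ ∑-concat (tabulate spreads) _ ⟩
    (∑[ Us ← tabulate spreads ] ∑[ U ← Us ] ⟦ S ≟ₛ U ⟧)
      ≡⟨ cong sum (trans (map-tabulate spreads _) (sym (map-tabulate (λ i → i) _))) ⟩
    (∑[ i ← allFin R ] ∑[ U ← spreads i ] ⟦ S ≟ₛ U ⟧)
      ≡⟨ ∑-cong (allFin R) (λ {i} _ → trans (∑-map proj₂ (row i) _) (∑-cong (row i) (λ {b} b∈ →
           ⟦⟧-cong (S ≟ₛ proj₂ b) ((0 , S) ≟ᵇ b) (cong₂ _,_ (sym (finished i b∈))) (cong proj₂)))) ⟩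
    (∑[ i ← allFin R ] count (0 , S) (row i))
      ≡⟨ complete S z≤n ⟩
    0 C 0 ∎
    where open ≤-Reasoning

complete⇒realizable : ∀ {N} T → All (IsShape N) T → (∀ k → k ≤ N → (∑[ M ← T ] μ M k) ≡ N C k) → Realizable N T
complete⇒realizable {N} T shapes total =
  final T (exhaust N (+-identityʳ N) (initial (lookup T) (All.lookup shapes ∘ ∈-lookup) total′))
  where
  total′ : ∀ k → k ≤ N → (∑[ i ← allFin (length T) ] μ (lookup T i) k) ≡ N C k
  total′ k k≤ = begin
    (∑[ i ← allFin (length T) ] μ (lookup T i) k)          ≡⟨ ∑-map (lookup T) (allFin (length T)) (λ M → μ M k) ⟨
    (∑[ M ← map (lookup T) (allFin (length T)) ] μ M k)    ≡⟨ cong (λ xs → ∑[ M ← xs ] μ M k) (map-tabulate (λ i → i) (lookup T)) ⟩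
    (∑[ M ← tabulate (lookup T) ] μ M k)                   ≡⟨ cong (λ xs → ∑[ M ← xs ] μ M k) (tabulate-lookup T) ⟩
    (∑[ M ← T ] μ M k)                                     ≡⟨ total k k≤ ⟩
    N C k                                                  ∎
    where open ≡-Reasoning

-- Padding an admissible type with singletons

singletons : (ℕ → ℕ) → ℕ → Type
singletons e zero    = []
singletons e (suc m) = replicate (e m) [ m ] ++ singletons e m

singletons-shapes : ∀ {N} e m → m ≤ suc N → All (IsShape N) (singletons e m)
singletons-shapes e zero    m≤ = []
singletons-shapes e (suc m) m≤ = All.++⁺
  (All.replicate⁺ (e m) (≤-trans (≤-reflexive (+-identityʳ m)) (≤-pred m≤)))
  (singletons-shapes e m (≤-trans (n≤1+n m) m≤))

∑-replicate : ∀ n (x : A) f → ∑ (replicate n x) f ≡ n * f x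
∑-replicate zero    x f = refl
∑-replicate (suc n) x f = cong (f x +_) (∑-replicate n x f)

μ-[] : ∀ m k → μ [ m ] k ≡ ⟦ k ≟ m ⟧
μ-[] m k = trans (μ≡∑ [ m ] k) (+-identityʳ _)

singletons-≥ : ∀ e m {k} → m ≤ k → (∑[ M ← singletons e m ] μ M k) ≡ 0
singletons-≥ e zero    m≤k = refl
singletons-≥ e (suc m) {k} m<k = begin
  (∑[ M ← replicate (e m) [ m ] ++ singletons e m ] μ M k)                ≡⟨ ∑-++ (replicate (e m) [ m ]) _ _ ⟩
  (∑[ M ← replicate (e m) [ m ] ] μ M k) + (∑[ M ← singletons e m ] μ M k)
    ≡⟨ cong₂ _+_ (∑-replicate (e m) [ m ] _) (singletons-≥ e m (<⇒≤ m<k)) ⟩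
  e m * μ [ m ] k + 0
    ≡⟨ cong (λ x → e m * x + 0) (trans (μ-[] m k) (⟦⟧-no (k ≟ m) (>⇒≢ m<k))) ⟩
  e m * 0 + 0                                                             ≡⟨ cong (_+ 0) (*-zeroʳ (e m)) ⟩
  0                                                                       ∎
  where open ≡-Reasoning

singletons-< : ∀ e m {k} → k < m → (∑[ M ← singletons e m ] μ M k) ≡ e k
singletons-< e (suc m) {k} k<1+m = begin
  (∑[ M ← replicate (e m) [ m ] ++ singletons e m ] μ M k)                ≡⟨ ∑-++ (replicate (e m) [ m ]) _ _ ⟩
  (∑[ M ← replicate (e m) [ m ] ] μ M k) + (∑[ M ← singletons e m ] μ M k)
    ≡⟨ cong (_+ (∑[ M ← singletons e m ] μ M k)) (trans (∑-replicate (e m) [ m ] _) (cong (e m *_) (μ-[] m k))) ⟩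
  e m * ⟦ k ≟ m ⟧ + (∑[ M ← singletons e m ] μ M k)              ≡⟨ split (k ≟ m) ⟩
  e k                                                                     ∎
  where
  open ≡-Reasoning
  -- Either `k` is the top layer and the lower layers contribute nothing, or it is found further
  -- down.
  split : (k≟m : Dec (k ≡ m)) → e m * ⟦ k≟m ⟧ + (∑[ M ← singletons e m ] μ M k) ≡ e k
  split (yes refl) = trans (cong₂ _+_ (*-identityʳ (e m)) (singletons-≥ e m ≤-refl)) (+-identityʳ (e m))
  split (no k≢m)   = cong₂ _+_ (*-zeroʳ (e m)) (singletons-< e m (≤∧≢⇒< (≤-pred k<1+m) k≢m))

Unique-++⁻ˡ : ∀ (xs : List A) {ys} → Unique (xs ++ ys) → Unique xs
Unique-++⁻ˡ []       u        = []
Unique-++⁻ˡ (x ∷ xs) (x∉ ∷ u) = All.++⁻ˡ xs x∉ ∷ Unique-++⁻ˡ xs u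

-- Realizability leaves the family of subsets free, so the spreads of the padding can be discarded
-- together with their members.
realizable-++⁻ˡ : ∀ {N} T {T′} → Realizable N (T ++ T′) → Realizable N T
realizable-++⁻ˡ T (𝒞 , (unique , spreads) , shapes) with splitPointwise T shapes
  where
  splitPointwise : ∀ {R : List (Subset _) → Shape → Set} {𝒞} T {T′} → Pointwise R 𝒞 (T ++ T′) →
                   ∃₂ λ 𝒞₁ 𝒞₂ → 𝒞 ≡ 𝒞₁ ++ 𝒞₂ × Pointwise R 𝒞₁ T
  splitPointwise []      rs       = [] , _ , refl , []
  splitPointwise (M ∷ T) (r ∷ rs) with 𝒞₁ , 𝒞₂ , refl , rs₁ ← splitPointwise T rs = _ ∷ 𝒞₁ , 𝒞₂ , refl , r ∷ rs₁
... | 𝒞₁ , 𝒞₂ , refl , shapes₁ =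
  𝒞₁ , (Unique-++⁻ˡ (concat 𝒞₁) (subst Unique (sym (concat-++ 𝒞₁ 𝒞₂)) unique) , All.++⁻ˡ 𝒞₁ spreads) , shapes₁

admissible⇒realizable : ∀ {N} T → All (IsShape N) T → Admissible N T → Realizable N T
admissible⇒realizable {N} T shapes admissible = realizable-++⁻ˡ T
  (complete⇒realizable (T ++ padding) (All.++⁺ shapes (singletons-shapes missing (suc N) ≤-refl)) λ k k≤ → begin
    (∑[ M ← T ++ padding ] μ M k)                          ≡⟨ ∑-++ T padding _ ⟩
    (∑[ M ← T ] μ M k) + (∑[ M ← padding ] μ M k)          ≡⟨ cong ((∑[ M ← T ] μ M k) +_) (singletons-< missing (suc N) (s≤s k≤)) ⟩
    -- Admissibility makes this truncated difference exact.
    (∑[ M ← T ] μ M k) + (N C k ∸ (∑[ M ← T ] μ M k))      ≡⟨ m+[n∸m]≡n (admissible k k≤) ⟩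
    N C k                                                  ∎)
  where
  open ≡-Reasoning
  missing : ℕ → ℕ
  missing k = N C k ∸ (∑[ M ← T ] μ M k)
  padding : Type
  padding = singletons missing (suc N)

-- Necessity: counting subsets by size

∑-subsets : ∀ N x → (∑[ S ← subsets N ] ⟦ x ≟ ∣ S ∣ ⟧) ≡ N C x
∑-subsets zero    zero    = refl
∑-subsets zero    (suc x) = refl
∑-subsets (suc N) x = begin
  (∑[ S ← map (outside ∷_) (subsets N) ++ map (inside ∷_) (subsets N) ] ⟦ x ≟ ∣ S ∣ ⟧)
    ≡⟨ ∑-++ (map (outside ∷_) (subsets N)) _ _ ⟩
  (∑[ S ← map (outside ∷_) (subsets N) ] ⟦ x ≟ ∣ S ∣ ⟧) + (∑[ S ← map (inside ∷_) (subsets N) ] ⟦ x ≟ ∣ S ∣ ⟧)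
    ≡⟨ cong₂ _+_ (∑-map (outside ∷_) (subsets N) _) (∑-map (inside ∷_) (subsets N) _) ⟩
  (∑[ S ← subsets N ] ⟦ x ≟ ∣ S ∣ ⟧) + (∑[ S ← subsets N ] ⟦ x ≟ suc ∣ S ∣ ⟧)
    ≡⟨ pascal x ⟩
  suc N C x ∎
  where
  open ≡-Reasoning
  pascal : ∀ x → (∑[ S ← subsets N ] ⟦ x ≟ ∣ S ∣ ⟧) + (∑[ S ← subsets N ] ⟦ x ≟ suc ∣ S ∣ ⟧) ≡ suc N C x
  pascal zero    = trans (cong₂ _+_ (trans (∑-subsets N 0) (nC0≡1 N)) (∑-zero (subsets N) λ _ → refl)) (sym (nC0≡1 (suc N)))
  pascal (suc x) = begin
    (∑[ S ← subsets N ] ⟦ suc x ≟ ∣ S ∣ ⟧) + (∑[ S ← subsets N ] ⟦ suc x ≟ suc ∣ S ∣ ⟧)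
      ≡⟨ cong₂ _+_ (∑-subsets N (suc x)) (∑-cong (subsets N) λ {S} _ →
           ⟦⟧-cong (suc x ≟ suc ∣ S ∣) (x ≟ ∣ S ∣) suc-injective (cong suc)) ⟩
    N C suc x + (∑[ S ← subsets N ] ⟦ x ≟ ∣ S ∣ ⟧)
      ≡⟨ cong (N C suc x +_) (∑-subsets N x) ⟩
    N C suc x + N C x
      ≡⟨ +-comm (N C suc x) (N C x) ⟩
    N C x + N C suc x
      ≡⟨ nCk+nC[k+1]≡[n+1]C[k+1] N x ⟩
    suc N C suc x ∎

-- The members of size `x` are grouped by the subset they are equal to; as no member is repeated,
-- each of the `N C x` subsets of that size contributes at most 1.
realizable⇒admissible : ∀ {N} T → Realizable N T → Admissible N T
realizable⇒admissible {N} T (𝒞 , (unique , _) , shapes) x _ = begin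
  (∑[ M ← T ] μ M x)
    ≡⟨ sizes shapes ⟩
  (∑[ S ← L ] ⟦ x ≟ ∣ S ∣ ⟧)
    ≡⟨ ∑-cong L (λ {S} _ → SubsetMultiplicity.∑-δ (λ U → ⟦ x ≟ ∣ U ∣ ⟧) (subsets-unique N) (∈-subsets S)) ⟨
  (∑[ S ← L ] ∑[ U ← subsets N ] (⟦ U ≟ₛ S ⟧ * ⟦ x ≟ ∣ U ∣ ⟧))
    ≡⟨ ∑-swap L (subsets N) (λ S U → ⟦ U ≟ₛ S ⟧ * ⟦ x ≟ ∣ U ∣ ⟧) ⟩
  (∑[ U ← subsets N ] ∑[ S ← L ] (⟦ U ≟ₛ S ⟧ * ⟦ x ≟ ∣ U ∣ ⟧))
    ≡⟨ ∑-cong (subsets N) (λ {U} _ → ∑-*ʳ L ⟦ x ≟ ∣ U ∣ ⟧ (λ S → ⟦ U ≟ₛ S ⟧)) ⟩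
  (∑[ U ← subsets N ] (SubsetMultiplicity.count U L * ⟦ x ≟ ∣ U ∣ ⟧))
    ≤⟨ ∑-mono-≤ (subsets N) (λ {U} _ → ≤-trans
         (*-monoˡ-≤ ⟦ x ≟ ∣ U ∣ ⟧ (SubsetMultiplicity.Unique⇒count≤1 unique U)) (≤-reflexive (*-identityˡ _))) ⟩
  (∑[ U ← subsets N ] ⟦ x ≟ ∣ U ∣ ⟧)
    ≡⟨ ∑-subsets N x ⟩
  N C x ∎
  where
  open ≤-Reasoning
  L : List (Subset N)
  L = concat 𝒞
  sizes : ∀ {𝒞 T} → Pointwise (λ Us M → shapeOf Us ↭ M) 𝒞 T →
          (∑[ M ← T ] μ M x) ≡ (∑[ S ← concat 𝒞 ] ⟦ x ≟ ∣ S ∣ ⟧)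
  sizes []                               = refl
  sizes {Us ∷ 𝒞} {M ∷ T} (shape ∷ shapes) = trans
    (cong₂ _+_ (trans (μ≡∑ M x) (trans (sym (∑-↭ _ shape)) (∑-map ∣_∣ Us _))) (sizes shapes))
    (sym (∑-++ Us (concat 𝒞) _))

theorem2p4 : (N : ℕ) → 1 ≤ N → (T : Type) → All (IsShape N) T →
    Realizable N T ⇔ Admissible N T
theorem2p4 N _ T shapes = mk⇔ (realizable⇒admissible T) (admissible⇒realizable T shapes)
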